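{- Let $G$ be a $k$-connected chordal graph with $|V(G)|\geq k+2$, and let $T$ be a tree decomposition of $G$ in which the label $l(x)$ of every node $x\in V(T)$ induces a maximal clique of $G$. An edge $e=\{u,v\}\in E(G)$ is contractible if and only if one of the following holds: (i) $e$ is contained in a unique maximal clique of $G$; (ii) for every edge $\{x,y\}\in E(T)$ with $\{u,v\}\subseteq l(x)\cap l(y)$, we have $|l(x)\cap l(y)|>k$.
   Context: A graph is chordal if it is simple and has no chordless cycle (a cycle of length at least 4 with no chord). A tree decomposition of $G$ is a tree $T$ with a label $l(x)\subseteq V(G)$ for each node $x$, such that every vertex of $G$ lies in some label, every edge of $G$ has both endpoints in some label, and for each $v\in V(G)$ the set of nodes whose labels contain $v$ induces a connected subtree of $T$. $\kappa(G)$ denotes vertex connectivity. For an edge $e=\{u,v\}$, $G.e$ is the graph obtained by contracting $e$: $u,v$ are replaced by a new vertex $z_{uv}$ adjacent to every neighbor of $u$ or $v$ (other than $u,v$), all other edges kept. An edge $e$ is contractible if $\kappa(G.e)=\kappa(G)$.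
   Formalization: "Contractible" is taken as κ(G.e) ≥ κ(G), since with equality the claim fails (triangle with a pendant edge: contracting the pendant edge raises κ from 1 to 2); "k-connected" is taken as κ(G) = k, since with κ(G) ≥ k it fails for K4 minus an edge, k = 1. -}

module Defs where

open import Data.Fin using (Fin; zero; suc; toℕ)
open import Data.Fin.Properties using (any?; all?)
open import Data.Fin.Subset
  using (Subset; inside; _∈_; _⊆_; _⊃_; _∩_; _∪_; _-_; ∁; ⁅_⁆; ∣_∣; Nonempty)
open import Data.Fin.Subset.Induction using (⊃-wellFounded)
open import Data.Fin.Subset.Properties
  using (_∈?_; _⊆?_; anySubset?; x∈p∩q⁺; p⊆p∪q; q⊆p∪q; x∈p∪q⁻; x∈⁅x⁆;
         x∈⁅y⁆⇒x≡y; ∩-inverseʳ; ∣⊥∣≡0)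
open import Data.Nat using (ℕ; suc; _≤_; _<_; _≥_; _≤?_; z≤n)
open import Data.Nat.Induction using (<-wellFounded)
open import Data.Nat.Properties using (≮⇒≥)
open import Data.Product using (_×_; _,_; ∃; ∃₂; ∃!; proj₁)
open import Data.Sum using (_⊎_; inj₂; [_,_])
open import Data.Vec using (_∷_; lookup; tabulate; here; there)
open import Function using (id)
open import Induction.WellFounded using (Acc; acc)
open import Level using (0ℓ)
open import Relation.Binary using (Rel; Decidable; Symmetric; Irreflexive)
open import Relation.Binary.Construct.Closure.ReflexiveTransitive
  using (Star; ε; _◅_; _◅◅_)
open import Relation.Binary.PropositionalEquality using (_≡_; _≢_; refl; sym; subst)
open import Relation.Nullary using (¬_; Dec; yes; no; contradiction)
open import Relation.Nullary.Decidable using (_×-dec_; _⊎-dec_; _→-dec_; ¬?; map′)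

private
  variable
    n : ℕ

-- A finite simple graph whose vertex set V is a subset of the pool Fin n.
record Graph (n : ℕ) : Set₁ where
  field
    V      : Subset n
    Adj    : Rel (Fin n) 0ℓ
    adj?   : Decidable Adj
    symm   : Symmetric Adj
    irrefl : Irreflexive _≡_ Adj
    adj⇒∈V : ∀ {u v} → Adj u v → u ∈ V

open Graph

-- S need not be contained in V G.
induced : Graph n → Subset n → Graph n
induced G S .V = V G ∩ S
induced G S .Adj u v = Adj G u v × u ∈ S × v ∈ S
induced G S .adj? u v = adj? G u v ×-dec (u ∈? S ×-dec v ∈? S)
induced G S .symm (uv , u∈S , v∈S) = symm G uv , v∈S , u∈S
induced G S .irrefl u≡v (uv , _) = irrefl G u≡v uv
induced G S .adj⇒∈V (uv , u∈S , _) = x∈p∩q⁺ (adj⇒∈V G uv , u∈S)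

infixl 5 _∖_

_∖_ : Graph n → Subset n → Graph n
G ∖ S = induced G (∁ S)

Connected : Graph n → Set
Connected G = ∀ {u v} → u ∈ V G → v ∈ V G → Star (Adj G) u v

-- Successor in the cyclic order 0, 1, …, ℓ - 1, 0.
Next : ∀ {ℓ} → Rel (Fin ℓ) 0ℓ
Next {ℓ} i j = suc (toℕ i) ≡ toℕ j ⊎ (suc (toℕ i) ≡ ℓ × toℕ j ≡ 0)

record Cycle (G : Graph n) (ℓ : ℕ) : Set where
  field
    3≤ℓ       : 3 ≤ ℓ
    vertex    : Fin ℓ → Fin n
    injective : ∀ {i j} → vertex i ≡ vertex j → i ≡ j
    adjacent  : ∀ {i j} → Next i j → Adj G (vertex i) (vertex j)

HasChord : {G : Graph n} {ℓ : ℕ} → Cycle G ℓ → Set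
HasChord {G = G} C =
  ∃₂ λ i j → Adj G (vertex i) (vertex j) × ¬ Next i j × ¬ Next j i
  where open Cycle C

Chordal : Graph n → Set
Chordal G = ∀ {ℓ} (C : Cycle G ℓ) → ¬ (ℓ ≥ 4 × ¬ HasChord C)

record IsTree (T : Graph n) : Set where
  field
    nonempty  : Nonempty (V T)
    connected : Connected T
    acyclic   : ∀ {ℓ} → ¬ Cycle T ℓ

record TreeDecomposition (G : Graph n) (m : ℕ) : Set₁ where
  field
    T      : Graph m
    isTree : IsTree T
    label  : Fin m → Subset n

  nodes : Fin n → Subset m
  nodes v = tabulate λ x → lookup (label x) v

  field
    label⊆V     : ∀ {x} → x ∈ V T → label x ⊆ V G
    coverVertex : ∀ {v} → v ∈ V G → ∃ λ x → x ∈ V T × v ∈ label x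
    coverEdge   : ∀ {u v} → Adj G u v → ∃ λ x → x ∈ V T × u ∈ label x × v ∈ label x
    subtree     : ∀ {v} → v ∈ V G → IsTree (induced T (nodes v))

Clique : Graph n → Subset n → Set
Clique G Q = Q ⊆ V G × (∀ {u v} → u ∈ Q → v ∈ Q → u ≢ v → Adj G u v)

MaximalClique : Graph n → Subset n → Set
MaximalClique G Q = Clique G Q × (∀ {Q′} → Clique G Q′ → Q ⊆ Q′ → Q′ ≡ Q)

-- Deleting S leaves a disconnected graph or at most one vertex.  The second
-- alternative gives a complete graph on p ≥ 1 vertices connectivity p - 1.
Disconnecting : Graph n → Subset n → Set
Disconnecting G S = S ⊆ V G × (¬ Connected (G ∖ S) ⊎ ∣ V (G ∖ S) ∣ ≤ 1)

IsVertexConnectivity : Graph n → ℕ → Set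
IsVertexConnectivity G k =
  (∃ λ S → Disconnecting G S × ∣ S ∣ ≡ k) ×
  (∀ {S} → Disconnecting G S → k ≤ ∣ S ∣)

private
  component : (G : Graph n) (u : Fin n) (A : Subset n) → Acc _⊃_ A →
              u ∈ A → (∀ {w} → w ∈ A → Star (Adj G) u w) →
              ∃ λ B → u ∈ B × (∀ {w} → w ∈ B → Star (Adj G) u w) ×
                      (∀ {a b} → a ∈ B → Adj G a b → b ∈ B)
  component G u A (acc rec) u∈A reach
    with any? (λ a → any? (λ b → a ∈? A ×-dec (adj? G a b ×-dec ¬? (b ∈? A))))
  ... | yes (a , b , a∈A , ab , b∉A) =
    component G u (A ∪ ⁅ b ⁆)
      (rec (p⊆p∪q ⁅ b ⁆ , b , q⊆p∪q A ⁅ b ⁆ (x∈⁅x⁆ b) , b∉A))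
      (p⊆p∪q ⁅ b ⁆ u∈A)
      λ w∈ → [ reach
             , (λ w∈b → subst (Star (Adj G) u) (sym (x∈⁅y⁆⇒x≡y b w∈b))
                              (reach a∈A ◅◅ ab ◅ ε))
             ] (x∈p∪q⁻ A ⁅ b ⁆ w∈)
  ... | no ¬exit = A , u∈A , reach , closed
    where
    closed : ∀ {a b} → a ∈ A → Adj G a b → b ∈ A
    closed {a} {b} a∈A ab with b ∈? A
    ... | yes b∈A = b∈A
    ... | no  b∉A = contradiction (a , b , a∈A , ab , b∉A) ¬exit

  stays : (G : Graph n) {B : Subset n} → (∀ {a b} → a ∈ B → Adj G a b → b ∈ B) →
          ∀ {u v} → u ∈ B → Star (Adj G) u v → v ∈ B
  stays G closed u∈B ε         = u∈B
  stays G closed u∈B (uw ◅ wv) = stays G closed (closed u∈B uw) wv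

reachable? : (G : Graph n) → Decidable (Star (Adj G))
reachable? G u v
  with component G u ⁅ u ⁆ (⊃-wellFounded ⁅ u ⁆) (x∈⁅x⁆ u)
         (λ w∈ → subst (Star (Adj G) u) (sym (x∈⁅y⁆⇒x≡y u w∈)) ε)
... | B , u∈B , reach , closed = map′ reach (stays G closed u∈B) (v ∈? B)

connected? : (G : Graph n) → Dec (Connected G)
connected? G = map′ (λ f {u} {v} → f u v) (λ f u v → f)
  (all? λ u → all? λ v → u ∈? V G →-dec (v ∈? V G →-dec reachable? G u v))

disconnecting? : (G : Graph n) (S : Subset n) → Dec (Disconnecting G S)
disconnecting? G S =
  S ⊆? V G ×-dec (¬? (connected? (G ∖ S)) ⊎-dec (∣ V (G ∖ S) ∣ ≤? 1))

private
  smallest : (G : Graph n) (S : Subset n) → Acc _<_ ∣ S ∣ → Disconnecting G S →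
             ∃ (IsVertexConnectivity G)
  smallest G S (acc rec) d
    with anySubset? (λ S′ → disconnecting? G S′ ×-dec (suc ∣ S′ ∣ ≤? ∣ S ∣))
  ... | yes (S′ , d′ , S′<S) = smallest G S′ (rec S′<S) d′
  ... | no ¬smaller =
    ∣ S ∣ , (S , d , refl) , λ {S′} d′ → ≮⇒≥ λ S′<S → ¬smaller (S′ , d′ , S′<S)

vertexConnectivity : (G : Graph n) → ∃ (IsVertexConnectivity G)
vertexConnectivity {n} G = smallest G (V G) (<-wellFounded _) (id , inj₂ ∣G∖V∣≤1)
  where
  ∣G∖V∣≤1 : ∣ V (G ∖ V G) ∣ ≤ 1
  ∣G∖V∣≤1 rewrite ∩-inverseʳ (V G) | ∣⊥∣≡0 n = z≤n

κ : Graph n → ℕ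
κ G = proj₁ (vertexConnectivity G)

-- The vertex zero is the new vertex replacing u and v; suc w is the old w.
data ContractAdj (G : Graph n) (u v : Fin n) : Rel (Fin (suc n)) 0ℓ where
  new-old : ∀ {w} → w ∈ V G - u - v → Adj G u w ⊎ Adj G v w →
            ContractAdj G u v zero (suc w)
  old-new : ∀ {w} → w ∈ V G - u - v → Adj G u w ⊎ Adj G v w →
            ContractAdj G u v (suc w) zero
  old-old : ∀ {a b} → a ∈ V G - u - v → b ∈ V G - u - v → Adj G a b →
            ContractAdj G u v (suc a) (suc b)

contract : Graph n → Fin n → Fin n → Graph (suc n)
contract G u v .V   = inside ∷ (V G - u - v)
contract G u v .Adj = ContractAdj G u v
contract G u v .adj? zero zero = no λ ()
contract G u v .adj? zero (suc w) =
  map′ (λ (w∈ , uvw) → new-old w∈ uvw) (λ { (new-old w∈ uvw) → w∈ , uvw })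
       (w ∈? (V G - u - v) ×-dec (adj? G u w ⊎-dec adj? G v w))
contract G u v .adj? (suc w) zero =
  map′ (λ (w∈ , uvw) → old-new w∈ uvw) (λ { (old-new w∈ uvw) → w∈ , uvw })
       (w ∈? (V G - u - v) ×-dec (adj? G u w ⊎-dec adj? G v w))
contract G u v .adj? (suc a) (suc b) =
  map′ (λ (a∈ , b∈ , ab) → old-old a∈ b∈ ab)
       (λ { (old-old a∈ b∈ ab) → a∈ , b∈ , ab })
       (a ∈? (V G - u - v) ×-dec (b ∈? (V G - u - v) ×-dec adj? G a b))
contract G u v .symm (new-old w∈ uvw)   = old-new w∈ uvw
contract G u v .symm (old-new w∈ uvw)   = new-old w∈ uvw
contract G u v .symm (old-old a∈ b∈ ab) = old-old b∈ a∈ (symm G ab)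
contract G u v .irrefl refl (old-old _ _ aa) = irrefl G refl aa
contract G u v .adj⇒∈V (new-old _ _)    = here
contract G u v .adj⇒∈V (old-new w∈ _)   = there w∈
contract G u v .adj⇒∈V (old-old a∈ _ _) = there a∈

-- Contraction does not lower the connectivity.  It may raise it: contracting
-- the pendant edge of a triangle with a pendant edge turns κ = 1 into κ = 2.
-- Requiring equality would therefore exclude edges lying in a unique maximal
-- clique.
Contractible : Graph n → Fin n → Fin n → Set
Contractible G u v = κ (contract G u v) ≥ κ G

InUniqueMaximalClique : Graph n → Fin n → Fin n → Set
InUniqueMaximalClique G u v = ∃! _≡_ λ Q → MaximalClique G Q × u ∈ Q × v ∈ Q

{-# OPTIONS --safe #-}
module Submission where

-- The graph G ∖ S stays connected as soon as every edge xy of T satisfies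
-- l(x) ∩ l(y) ⊈ S, since the cliques l(x) then link up along T.  Conversely
-- l(x) ∩ l(y) separates G whenever l(x) ≢ l(y), so it has at least κ(G)
-- vertices, and so all labels have more than κ(G) vertices.  A set disconnecting
-- G.e with fewer than κ(G) vertices corresponds to a set S ⊇ {u, v} of at most
-- κ(G) vertices disconnecting G; some l(x) ∩ l(y) is contained in S and by
-- counting equal to it.  Hence e is contractible if and only if (ii) holds, and
-- (i) is the case of (ii) in which l(x) = l(y) for all edges xy in question.

open import Defs
open import Data.Bool using (true; false)
open import Data.Fin using (Fin; zero; suc; toℕ; fromℕ; _≟_)
open import Data.Fin.Properties using (any?; suc-injective; toℕ-injective; toℕ-fromℕ)
open import Data.Fin.Subset
  using (Subset; inside; outside; _∈_; _∉_; _⊆_; _∩_; _∪_; _-_; ∁; ⁅_⁆; ∣_∣)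
open import Data.Fin.Subset.Properties
open import Data.Nat using (ℕ; suc; pred; _+_; _≤_; _<_; _≥_; _>_; _≤?_; _<?_; z≤n; s≤s)
open import Data.Nat.Properties
  using (≤-refl; ≤-trans; ≤-reflexive; <-≤-trans; ≤-<-trans; <-irrefl; <⇒≱; ≰⇒>; ≮⇒≥;
         +-comm; +-suc; +-mono-≤; +-monoʳ-≤; n≤1+n; module ≤-Reasoning)
open import Data.Product using (_×_; _,_; ∃; proj₁; proj₂)
open import Data.Sum using (_⊎_; inj₁; inj₂; [_,_]; map)
open import Data.Vec using ([]; _∷_; lookup; tabulate; here; there)
open import Data.Vec.Properties using (lookup∘tabulate; []=⇒lookup; lookup⇒[]=)
open import Function using (_∘_)
open import Function.Bundles using (_⇔_; mk⇔; Equivalence)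
open import Function.Construct.Composition using (_⇔-∘_)
open import Level using (0ℓ)
open import Relation.Binary using (Rel)
open import Relation.Binary.Construct.Closure.ReflexiveTransitive as Star
  using (Star; ε; _◅_; _◅◅_)
open import Relation.Binary.PropositionalEquality
  using (_≡_; _≢_; refl; sym; trans; cong; subst; subst₂)
open import Relation.Nullary using (¬_; yes; no; contradiction)
open import Relation.Nullary.Decidable using (_×-dec_; ¬?; decidable-stable)
open Graph
open TreeDecomposition

private
  variable
    n m : ℕ

-- Finite subsets and their cardinalities.

x∉p-x : ∀ (p : Subset n) x → x ∉ p - x
x∉p-x (_ ∷ _) zero    ()
x∉p-x (_ ∷ p) (suc x) (there x∈) = x∉p-x p x x∈

x∈p-y⇒x∈p : ∀ {p : Subset n} {x} y → x ∈ p - y → x ∈ p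
x∈p-y⇒x∈p {p = p} y = p─q⊆p p ⁅ y ⁆

x∈p-y⇒x≢y : ∀ {p : Subset n} {x y} → x ∈ p - y → x ≢ y
x∈p-y⇒x≢y {p = p} {x} x∈ refl = x∉p-x p x x∈

x∈p-y-z⁺ : ∀ {p : Subset n} {x y z} → x ∈ p → x ≢ y → x ≢ z → x ∈ p - y - z
x∈p-y-z⁺ x∈p x≢y = x∈p∧x≢y⇒x∈p-y (x∈p∧x≢y⇒x∈p-y x∈p x≢y)

x∈p-y-z⁻ : ∀ {p : Subset n} {x} y z → x ∈ p - y - z → x ∈ p × x ≢ y × x ≢ z
x∈p-y-z⁻ y z x∈ =
  x∈p-y⇒x∈p y (x∈p-y⇒x∈p z x∈) , x∈p-y⇒x≢y (x∈p-y⇒x∈p z x∈) , x∈p-y⇒x≢y x∈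

∣p∪q∣≤∣p∣+∣q∣ : ∀ (p q : Subset n) → ∣ p ∪ q ∣ ≤ ∣ p ∣ + ∣ q ∣
∣p∪q∣≤∣p∣+∣q∣ []          []          = z≤n
∣p∪q∣≤∣p∣+∣q∣ (false ∷ p) (false ∷ q) = ∣p∪q∣≤∣p∣+∣q∣ p q
∣p∪q∣≤∣p∣+∣q∣ (false ∷ p) (true ∷ q)  =
  ≤-trans (s≤s (∣p∪q∣≤∣p∣+∣q∣ p q)) (≤-reflexive (sym (+-suc ∣ p ∣ ∣ q ∣)))
∣p∪q∣≤∣p∣+∣q∣ (true ∷ p)  (false ∷ q) = s≤s (∣p∪q∣≤∣p∣+∣q∣ p q)
∣p∪q∣≤∣p∣+∣q∣ (true ∷ p)  (true ∷ q)  =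
  s≤s (≤-trans (∣p∪q∣≤∣p∣+∣q∣ p q) (+-monoʳ-≤ ∣ p ∣ (n≤1+n ∣ q ∣)))

∣p∣≤1+∣p-x∣ : ∀ (p : Subset n) x → ∣ p ∣ ≤ suc ∣ p - x ∣
∣p∣≤1+∣p-x∣ p x = begin
  ∣ p ∣                    ≤⟨ p⊆q⇒∣p∣≤∣q∣ p⊆ ⟩
  ∣ ⁅ x ⁆ ∪ (p - x) ∣      ≤⟨ ∣p∪q∣≤∣p∣+∣q∣ ⁅ x ⁆ (p - x) ⟩
  ∣ ⁅ x ⁆ ∣ + ∣ p - x ∣    ≡⟨ cong (_+ ∣ p - x ∣) (∣⁅x⁆∣≡1 x) ⟩
  suc ∣ p - x ∣            ∎
  where
  open ≤-Reasoning
  p⊆ : p ⊆ ⁅ x ⁆ ∪ (p - x)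
  p⊆ {w} w∈p with w ≟ x
  ... | yes refl = p⊆p∪q (p - x) (x∈⁅x⁆ x)
  ... | no  w≢x  = q⊆p∪q ⁅ x ⁆ (p - x) (x∈p∧x≢y⇒x∈p-y w∈p w≢x)

-- Here `p ∩ ∁ q` has the shape of the vertex set left after deleting `q`, so survivors are counted
-- without subtraction.
∣p∣≤∣p∩∁q∣+∣q∣ : ∀ (p q : Subset n) → ∣ p ∣ ≤ ∣ p ∩ ∁ q ∣ + ∣ q ∣
∣p∣≤∣p∩∁q∣+∣q∣ p q = ≤-trans (p⊆q⇒∣p∣≤∣q∣ p⊆) (∣p∪q∣≤∣p∣+∣q∣ (p ∩ ∁ q) q)
  where
  p⊆ : p ⊆ (p ∩ ∁ q) ∪ q
  p⊆ {w} w∈p with w ∈? q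
  ... | yes w∈q = q⊆p∪q (p ∩ ∁ q) q w∈q
  ... | no  w∉q = p⊆p∪q q (x∈p∩q⁺ (w∈p , x∉p⇒x∈∁p w∉q))

p⊆q∧∣q∣≤∣p∣⇒q⊆p : ∀ {p q : Subset n} → p ⊆ q → ∣ q ∣ ≤ ∣ p ∣ → q ⊆ p
p⊆q∧∣q∣≤∣p∣⇒q⊆p {p = p} p⊆q ∣q∣≤∣p∣ {w} w∈q with w ∈? p
... | yes w∈p = w∈p
... | no  w∉p = contradiction ∣q∣≤∣p∣ (<⇒≱ (p⊂q⇒∣p∣<∣q∣ (p⊆q , w , w∈q , w∉p)))

⊆⊎∃∉ : ∀ (p q : Subset n) → p ⊆ q ⊎ ∃ λ x → x ∈ p × x ∉ q
⊆⊎∃∉ p q with any? (λ x → x ∈? p ×-dec ¬? (x ∈? q))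
... | yes x∈p∖q = inj₂ x∈p∖q
... | no  ¬∃    = inj₁ λ {x} x∈p → decidable-stable (x ∈? q) λ x∉q → ¬∃ (x , x∈p , x∉q)

∈-tabulate⁺ : ∀ {f : Fin n → _} {x} → f x ≡ inside → x ∈ tabulate f
∈-tabulate⁺ {f = f} {x} fx = lookup⇒[]= x (tabulate f) (trans (lookup∘tabulate f x) fx)

∈-tabulate⁻ : ∀ {f : Fin n → _} {x} → x ∈ tabulate f → f x ≡ inside
∈-tabulate⁻ {f = f} {x} x∈ = trans (sym (lookup∘tabulate f x)) ([]=⇒lookup x∈)

-- Simple paths in trees.

record Path (R : Rel (Fin m) 0ℓ) (a b : Fin m) : Set where
  field
    length    : ℕ
    vertex    : Fin (suc length) → Fin m
    first     : vertex zero ≡ a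
    last      : vertex (fromℕ length) ≡ b
    injective : ∀ {i j} → vertex i ≡ vertex j → i ≡ j
    step      : ∀ {i j} → suc (toℕ i) ≡ toℕ j → R (vertex i) (vertex j)

module _ {R : Rel (Fin m) 0ℓ} where
  open Path

  pathFrom : ∀ {a b} (P : Path R a b) i → Path R (vertex P i) b
  pathFrom P zero = record
    { length = length P ; vertex = vertex P ; first = refl ; last = last P
    ; injective = injective P ; step = step P }
  pathFrom record { length = suc ℓ ; vertex = f ; last = l ; injective = inj ; step = s } (suc i) =
    pathFrom record
      { length = ℓ ; vertex = f ∘ suc ; first = refl ; last = l
      ; injective = suc-injective ∘ inj ; step = s ∘ cong suc } i

  pathCons : ∀ {a b c} → R a b → (P : Path R b c) → (∀ i → vertex P i ≢ a) → Path R a c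
  pathCons {a} ab P a∉P = record
    { length = suc (length P) ; vertex = f ; first = refl ; last = last P
    ; injective = inj ; step = st }
    where
    f : Fin (suc (suc (length P))) → Fin _
    f zero    = a
    f (suc i) = vertex P i
    inj : ∀ {i j} → f i ≡ f j → i ≡ j
    inj {zero}  {zero}  _  = refl
    inj {zero}  {suc j} eq = contradiction (sym eq) (a∉P j)
    inj {suc i} {zero}  eq = contradiction eq (a∉P i)
    inj {suc i} {suc j} eq = cong suc (injective P eq)
    st : ∀ {i j} → suc (toℕ i) ≡ toℕ j → R (f i) (f j)
    st {zero}  {suc zero} _    = subst (R a) (sym (first P)) ab
    st {suc i} {suc j}    i+1≡j = step P (cong pred i+1≡j)

  -- Loop erasure: if `a` already occurs on the path made from the rest of the walk, everything
  -- before it is dropped; otherwise `a` is prepended.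
  star⇒path : ∀ {a b} → Star R a b → Path R a b
  star⇒path {a} ε = record
    { length = 0 ; vertex = λ _ → a ; first = refl ; last = refl
    ; injective = λ { {zero} {zero} _ → refl } ; step = λ { {_} {zero} () } }
  star⇒path {a} (ab ◅ bc) with star⇒path bc
  ... | P with any? (λ i → vertex P i ≟ a)
  ... | yes (i , refl) = pathFrom P i
  ... | no  a∉P        = pathCons ab P λ i eq → a∉P (i , eq)

-- Banning one direction suffices: a simple path from `x` to `y` that uses the banned step consists
-- of that step alone.
Detour : (G : Graph n) (x y : Fin n) → Rel (Fin n) 0ℓ
Detour G x y p q = Adj G p q × ¬ (p ≡ x × q ≡ y)

-- After loop erasure, length 0 contradicts irreflexivity, length 1 is the banned step, and a longer
-- path closes up with the edge to a cycle.
no-detour : ∀ {G : Graph n} → IsTree G → ∀ {x y} → Adj G x y → ¬ Star (Detour G x y) x y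
no-detour {G = G} isT xy walk with star⇒path walk
... | record { length = 0 ; first = refl ; last = refl } = irrefl G refl xy
... | record { length = 1 ; first = refl ; last = refl ; step = step } =
  proj₂ (step {zero} {suc zero} refl) (refl , refl)
... | record { length = suc (suc ℓ) ; vertex = f ; first = refl ; last = refl
             ; injective = inj ; step = step } =
  IsTree.acyclic isT record
    { 3≤ℓ = s≤s (s≤s (s≤s z≤n)) ; vertex = f ; injective = inj ; adjacent = adjacent }
  where
  adjacent : ∀ {i j} → Next i j → Adj G (f i) (f j)
  adjacent (inj₁ i+1≡j) = proj₁ (step i+1≡j)
  -- The wrap-around pair is the last index and 0, that is, `y` followed by `x`.
  adjacent {i} {j} (inj₂ (i+1≡ℓ , j≡0)) =
    subst₂ (λ a b → Adj G (f a) (f b))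
      (toℕ-injective (trans (toℕ-fromℕ _) (cong pred (sym i+1≡ℓ))))
      (toℕ-injective (sym j≡0)) (symm G xy)

-- Separators and maximal cliques.

Separator : Graph n → Subset n → Set
Separator G S = S ⊆ V G × ¬ Connected (G ∖ S)

-- The proof works with an abstract lower bound k instead of κ, because unfolding
-- κ G during type checking runs the search for a smallest separator.
KConnected : ℕ → Graph n → Set
KConnected k G = ∀ S → Disconnecting G S → k ≤ ∣ S ∣

k≤∣separator∣ : ∀ (G : Graph n) {k S} → KConnected k G → Separator G S → k ≤ ∣ S ∣
k≤∣separator∣ _ k-conn (S⊆V , ¬conn) = k-conn _ (S⊆V , inj₁ ¬conn)

-- Distinct maximal cliques are incomparable; applied both ways, this finds a private vertex for
-- each end of a tree edge.
maximal⇒≡⊎∃∉ : ∀ {G : Graph n} {P Q} → MaximalClique G P → MaximalClique G Q →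
               P ≡ Q ⊎ ∃ λ a → a ∈ P × a ∉ Q
maximal⇒≡⊎∃∉ {P = P} {Q} (_ , P-max) (Q-clique , _) with ⊆⊎∃∉ P Q
... | inj₁ P⊆Q = inj₁ (sym (P-max Q-clique P⊆Q))
... | inj₂ a   = inj₂ a

clique-walk : ∀ (G : Graph n) {Q S a b} → Clique G Q → a ∈ Q → b ∈ Q → a ∉ S → b ∉ S →
              Star (Adj (G ∖ S)) a b
clique-walk G {a = a} {b} (_ , adj) a∈Q b∈Q a∉S b∉S with a ≟ b
... | yes refl = ε
... | no  a≢b  = (adj a∈Q b∈Q a≢b , x∉p⇒x∈∁p a∉S , x∉p⇒x∈∁p b∉S) ◅ ε

-- Separation and connection along the decomposition tree.

module _ {G : Graph n} (D : TreeDecomposition G m) where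

  module _ {x y} (xy : Adj (T D) x y) where

    private
      S = label D x ∩ label D y

      -- The vertices occurring on the `x` side of the tree edge. Outside `S` the choice of the node
      -- `s` is immaterial, by `one-side`.
      Beyond : Fin n → Set
      Beyond w = ∃ λ s → s ∈ V (T D) × w ∈ label D s × Star (Detour (T D) x y) x s

      -- The nodes holding `w` are connected in `T`, and as `w` is not in both end labels, a walk
      -- among them never crosses the edge.
      one-side : ∀ {w t} → w ∉ S → Beyond w → t ∈ V (T D) → w ∈ label D t →
                 Star (Detour (T D) x y) x t
      one-side {w} w∉S (s , s∈T , w∈s , xs) t∈T w∈t =
        xs ◅◅ Star.map
          (λ { (pq , p∈ , q∈) → pq , λ { (refl , refl) →
                 w∉S (x∈p∩q⁺ (∈nodes⁻ p∈ , ∈nodes⁻ q∈)) } })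
          (IsTree.connected (subtree D (label⊆V D s∈T w∈s))
            (x∈p∩q⁺ (s∈T , ∈nodes⁺ w∈s)) (x∈p∩q⁺ (t∈T , ∈nodes⁺ w∈t)))
        where
        ∈nodes⁻ : ∀ {p} → p ∈ nodes D w → w ∈ label D p
        ∈nodes⁻ {p} p∈ = lookup⇒[]= w (label D p) (∈-tabulate⁻ p∈)
        ∈nodes⁺ : ∀ {p} → w ∈ label D p → p ∈ nodes D w
        ∈nodes⁺ w∈p = ∈-tabulate⁺ ([]=⇒lookup w∈p)

      -- Both ends of an edge of `G` share a label, and `one-side` carries the witness node to that
      -- label.
      stays-beyond : ∀ {a b} → Star (Adj (G ∖ S)) a b → Beyond a → Beyond b
      stays-beyond ε                      a-beyond = a-beyond
      stays-beyond ((ac , a∈ , _) ◅ walk) a-beyond with coverEdge D ac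
      ... | t , t∈T , a∈t , c∈t =
        stays-beyond walk (t , t∈T , c∈t , one-side (x∈∁p⇒x∉p a∈) a-beyond t∈T a∈t)

    -- A walk from `a` to `b` avoiding `S` would put `b` on the `x` side, hence give a detour from
    -- `x` to `y` in the tree.
    edge-separates : ∀ {a b} → a ∈ label D x → a ∉ label D y →
                     b ∈ label D y → b ∉ label D x → Separator G S
    edge-separates a∈x a∉y b∈y b∉x =
        (λ w∈ → label⊆V D x∈T (p∩q⊆p _ _ w∈))
      , λ conn → no-detour (isTree D) xy
          (one-side b∉S
            (stays-beyond
              (conn (x∈p∩q⁺ (label⊆V D x∈T a∈x , x∉p⇒x∈∁p a∉S))
                    (x∈p∩q⁺ (label⊆V D y∈T b∈y , x∉p⇒x∈∁p b∉S)))
              (x , x∈T , a∈x , ε))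
            y∈T b∈y)
      where
      x∈T = adj⇒∈V (T D) xy
      y∈T = adj⇒∈V (T D) (symm (T D) xy)
      a∉S = a∉y ∘ p∩q⊆q _ _
      b∉S = b∉x ∘ p∩q⊆p _ _

  module _ (maximal : ∀ {x} → x ∈ V (T D) → MaximalClique G (label D x)) where

    -- The vertex `a` is returned too, since it shows that the separator is a proper subset of
    -- `label D x`.
    edge-≡⊎separates : ∀ {x y} → Adj (T D) x y →
      label D x ≡ label D y ⊎
      Separator G (label D x ∩ label D y) × ∃ λ a → a ∈ label D x × a ∉ label D y
    edge-≡⊎separates {x} {y} xy
      with maximal⇒≡⊎∃∉ {G = G} (maximal (adj⇒∈V (T D) xy)) (maximal (adj⇒∈V (T D) (symm (T D) xy)))
         | maximal⇒≡⊎∃∉ {G = G} (maximal (adj⇒∈V (T D) (symm (T D) xy))) (maximal (adj⇒∈V (T D) xy))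
    ... | inj₁ x≡y             | _                    = inj₁ x≡y
    ... | inj₂ _               | inj₁ y≡x             = inj₁ (sym y≡x)
    ... | inj₂ (a , a∈x , a∉y) | inj₂ (b , b∈y , b∉x) =
      inj₂ (edge-separates xy a∈x a∉y b∈y b∉x , a , a∈x , a∉y)

    -- If a label had at most `k` vertices, an unequal neighbouring label would give a separator
    -- with fewer than `k`. So equality spreads over the whole tree, and this one label would cover
    -- `V G`.
    k<∣label∣ : ∀ {k} → KConnected k G → k < ∣ V G ∣ → ∀ {x} → x ∈ V (T D) → k < ∣ label D x ∣
    k<∣label∣ {k} k-conn k<∣V∣ {x} x∈T with k <? ∣ label D x ∣
    ... | yes k< = k<
    ... | no  k≮ = contradiction (≤-trans (p⊆q⇒∣p∣≤∣q∣ V⊆x) ∣x∣≤k) (<⇒≱ k<∣V∣)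
      where
      ∣x∣≤k = ≮⇒≥ k≮
      propagate : ∀ {p q} → label D p ≡ label D x → Star (Adj (T D)) p q →
                  label D q ≡ label D x
      propagate p≡x ε = p≡x
      propagate {p} p≡x (_◅_ {j = p′} pp′ walk) with edge-≡⊎separates pp′
      ... | inj₁ p≡p′ = propagate (trans (sym p≡p′) p≡x) walk
      ... | inj₂ (sep , a , a∈p , a∉p′) =
        contradiction (≤-trans (subst (λ Q → ∣ Q ∣ ≤ k) (sym p≡x) ∣x∣≤k) (k≤∣separator∣ G k-conn sep))
          (<⇒≱ (p⊂q⇒∣p∣<∣q∣ (p∩q⊆p _ (label D p′) , a , a∈p , a∉p′ ∘ p∩q⊆q (label D p) _)))
      V⊆x : V G ⊆ label D x
      V⊆x w∈V with coverVertex D w∈V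
      ... | t , t∈T , w∈t =
        subst (_ ∈_) (propagate refl (IsTree.connected (isTree D) x∈T t∈T)) w∈t

    k≤∣edge∣ : ∀ {k} → KConnected k G → k < ∣ V G ∣ → ∀ {x y} → Adj (T D) x y →
               k ≤ ∣ label D x ∩ label D y ∣
    k≤∣edge∣ k-conn k<∣V∣ {x} {y} xy with edge-≡⊎separates xy
    ... | inj₂ (sep , _) = k≤∣separator∣ G k-conn sep
    ... | inj₁ x≡y rewrite sym x≡y | ∩-idem (label D x) =
      ≤-trans (n≤1+n _) (k<∣label∣ k-conn k<∣V∣ (adj⇒∈V (T D) xy))

    -- Follow the tree from a label holding `a` to one holding `b`: inside each clique, one step
    -- reaches a surviving vertex shared with the next.
    connected-∖ : ∀ S → (∀ {x y} → Adj (T D) x y → ∃ λ w → w ∈ label D x ∩ label D y × w ∉ S) →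
                  Connected (G ∖ S)
    connected-∖ S link {a} {b} a∈ b∈
      with x∈p∩q⁻ (V G) _ a∈ | x∈p∩q⁻ (V G) _ b∈
    ... | a∈V , a∈∁S | b∈V , b∈∁S with coverVertex D a∈V | coverVertex D b∈V
    ... | s , s∈T , a∈s | t , t∈T , b∈t =
      along (IsTree.connected (isTree D) s∈T t∈T) s∈T a∈s (x∈∁p⇒x∉p a∈∁S)
      where
      along : ∀ {p c} → Star (Adj (T D)) p t → p ∈ V (T D) → c ∈ label D p → c ∉ S →
              Star (Adj (G ∖ S)) c b
      along ε p∈T c∈p c∉S =
        clique-walk G (proj₁ (maximal p∈T)) c∈p b∈t c∉S (x∈∁p⇒x∉p b∈∁S)
      along (pq ◅ walk) p∈T c∈p c∉S with link pq
      ... | w , w∈ , w∉S with x∈p∩q⁻ (label D _) _ w∈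
      ... | w∈p , w∈q =
        clique-walk G (proj₁ (maximal p∈T)) c∈p w∈p c∉S w∉S ◅◅
        along walk (adj⇒∈V (T D) (symm (T D) pq)) w∈q w∉S

-- Contraction of an edge.

module _ (G : Graph n) (u v : Fin n) where

  private
    G·e = contract G u v

  collapse : Fin n → Fin (suc n)
  collapse w with w ≟ u | w ≟ v
  ... | yes _ | _     = zero
  ... | no  _ | yes _ = zero
  ... | no  _ | no  _ = suc w

  -- Couples each case with the value of `collapse`, so that later proofs need not repeat the two
  -- equality tests.
  collapse-view : ∀ w → (w ≡ u ⊎ w ≡ v) × collapse w ≡ zero ⊎
                        (w ≢ u × w ≢ v) × collapse w ≡ suc w
  collapse-view w with w ≟ u | w ≟ v
  ... | yes w≡u | _       = inj₁ (inj₁ w≡u , refl)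
  ... | no  _   | yes w≡v = inj₁ (inj₂ w≡v , refl)
  ... | no  w≢u | no  w≢v = inj₂ ((w≢u , w≢v) , refl)

  collapse-u : collapse u ≡ zero
  collapse-u with collapse-view u
  ... | inj₁ (_ , eq)        = eq
  ... | inj₂ ((u≢u , _) , _) = contradiction refl u≢u

  collapse-v : collapse v ≡ zero
  collapse-v with collapse-view v
  ... | inj₁ (_ , eq)        = eq
  ... | inj₂ ((_ , v≢v) , _) = contradiction refl v≢v

  collapse-other : ∀ {w} → w ∈ V G - u - v → collapse w ≡ suc w
  collapse-other {w} w∈ with collapse-view w
  ... | inj₂ (_ , eq)         = eq
  ... | inj₁ (inj₁ w≡u , _)   = contradiction w≡u (proj₁ (proj₂ (x∈p-y-z⁻ u v w∈)))
  ... | inj₁ (inj₂ w≡v , _)   = contradiction w≡v (x∈p-y⇒x≢y w∈)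

  -- The equality covers `e` itself, whose ends merge.
  collapse-adj : ∀ {a b} → Adj G a b →
                 collapse a ≡ collapse b ⊎ Adj G·e (collapse a) (collapse b)
  collapse-adj {a} {b} ab with collapse-view a | collapse-view b
  ... | inj₁ (_ , a≡) | inj₁ (_ , b≡) = inj₁ (trans a≡ (sym b≡))
  ... | inj₁ (a∈e , a≡) | inj₂ ((b≢u , b≢v) , b≡) rewrite a≡ | b≡ =
    inj₂ (new-old (x∈p-y-z⁺ (adj⇒∈V G (symm G ab)) b≢u b≢v)
                  (map (λ { refl → ab }) (λ { refl → ab }) a∈e))
  ... | inj₂ ((a≢u , a≢v) , a≡) | inj₁ (b∈e , b≡) rewrite a≡ | b≡ =
    inj₂ (old-new (x∈p-y-z⁺ (adj⇒∈V G ab) a≢u a≢v)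
                  (map (λ { refl → symm G ab }) (λ { refl → symm G ab }) b∈e))
  ... | inj₂ ((a≢u , a≢v) , a≡) | inj₂ ((b≢u , b≢v) , b≡) rewrite a≡ | b≡ =
    inj₂ (old-old (x∈p-y-z⁺ (adj⇒∈V G ab) a≢u a≢v)
                  (x∈p-y-z⁺ (adj⇒∈V G (symm G ab)) b≢u b≢v) ab)

  preimage : Subset (suc n) → Subset n
  preimage S = tabulate (lookup S ∘ collapse)

  ∈preimage⁺ : ∀ {S w} → collapse w ∈ S → w ∈ preimage S
  ∈preimage⁺ w∈ = ∈-tabulate⁺ ([]=⇒lookup w∈)

  ∈preimage⁻ : ∀ {S w} → w ∈ preimage S → collapse w ∈ S
  ∈preimage⁻ {S} {w} w∈ = lookup⇒[]= (collapse w) S (∈-tabulate⁻ w∈)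

  collapse-walk : ∀ {S a b} → Star (Adj (G ∖ preimage S)) a b →
                  Star (Adj (G·e ∖ S)) (collapse a) (collapse b)
  collapse-walk ε = ε
  collapse-walk {S} ((ac , a∈ , c∈) ◅ walk) with collapse-adj ac
  ... | inj₁ eq = subst (λ z → Star (Adj (G·e ∖ S)) z _) (sym eq) (collapse-walk walk)
  ... | inj₂ a·c = (a·c , image a∈ , image c∈) ◅ collapse-walk walk
    where
    image : ∀ {w} → w ∈ ∁ (preimage S) → collapse w ∈ ∁ S
    image w∈ = x∉p⇒x∈∁p λ cw∈S → x∈∁p⇒x∉p w∈ (∈preimage⁺ cw∈S)

  module _ (uv : Adj G u v) where

    collapse-surjective : ∀ {z} → z ∈ V G·e → ∃ λ w → w ∈ V G × collapse w ≡ z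
    collapse-surjective here       = u , adj⇒∈V G uv , collapse-u
    collapse-surjective (there w∈) =
      _ , proj₁ (x∈p-y-z⁻ u v w∈) , collapse-other w∈

    preimage⊆V : ∀ {S} → S ⊆ V G·e → preimage S ⊆ V G
    preimage⊆V S⊆V {w} w∈ with collapse-view w
    ... | inj₁ (inj₁ refl , _) = adj⇒∈V G uv
    ... | inj₁ (inj₂ refl , _) = adj⇒∈V G (symm G uv)
    ... | inj₂ (_ , eq) with subst (_∈ V G·e) eq (S⊆V (∈preimage⁻ w∈))
    ... | there w∈′ = proj₁ (x∈p-y-z⁻ u v w∈′)

    -- Every surviving vertex of `G·e` is the collapse of a surviving vertex of `G`, and walks
    -- collapse to walks.
    preimage-connected : ∀ {S} → Connected (G ∖ preimage S) → Connected (G·e ∖ S)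
    preimage-connected {S} conn a∈ b∈ with x∈p∩q⁻ (V G·e) _ a∈ | x∈p∩q⁻ (V G·e) _ b∈
    ... | a∈V , a∈∁S | b∈V , b∈∁S with collapse-surjective a∈V | collapse-surjective b∈V
    ... | a , a∈G , refl | b , b∈G , refl =
      collapse-walk (conn (x∈p∩q⁺ (a∈G , x∉p⇒x∈∁p (x∈∁p⇒x∉p a∈∁S ∘ ∈preimage⁻)))
                          (x∈p∩q⁺ (b∈G , x∉p⇒x∈∁p (x∈∁p⇒x∉p b∈∁S ∘ ∈preimage⁻))))

    ∣V∣≤1+∣V·e∣ : ∣ V G ∣ ≤ suc ∣ V G·e ∣
    ∣V∣≤1+∣V·e∣ = ≤-trans (∣p∣≤1+∣p-x∣ (V G) u) (s≤s (∣p∣≤1+∣p-x∣ (V G - u) v))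

    ∣preimage∣-outside : ∀ P → ∣ preimage (outside ∷ P) ∣ ≤ ∣ P ∣
    ∣preimage∣-outside P = p⊆q⇒∣p∣≤∣q∣ pre⊆P
      where
      pre⊆P : preimage (outside ∷ P) ⊆ P
      pre⊆P {w} w∈ with collapse-view w | ∈preimage⁻ {outside ∷ P} w∈
      ... | inj₁ (_ , eq) | cw∈ with () ← subst (_∈ outside ∷ P) eq cw∈
      ... | inj₂ (_ , eq) | cw∈ = drop-there (subst (_∈ outside ∷ P) eq cw∈)

    -- This is one more than the size of `inside ∷ P`, because the new vertex expands to `u` and
    -- `v`.
    ∣preimage∣-inside : ∀ P → ∣ preimage (inside ∷ P) ∣ ≤ suc (suc ∣ P ∣)
    ∣preimage∣-inside P = begin
      ∣ Q ∣                    ≤⟨ ∣p∣≤1+∣p-x∣ Q u ⟩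
      suc ∣ Q - u ∣            ≤⟨ s≤s (∣p∣≤1+∣p-x∣ (Q - u) v) ⟩
      suc (suc ∣ Q - u - v ∣)  ≤⟨ s≤s (s≤s (p⊆q⇒∣p∣≤∣q∣ Q-u-v⊆P)) ⟩
      suc (suc ∣ P ∣)          ∎
      where
      open ≤-Reasoning
      Q = preimage (inside ∷ P)
      Q-u-v⊆P : Q - u - v ⊆ P
      Q-u-v⊆P {w} w∈ with collapse-view w
      ... | inj₁ (inj₁ w≡u , _) = contradiction w≡u (proj₁ (proj₂ (x∈p-y-z⁻ u v w∈)))
      ... | inj₁ (inj₂ w≡v , _) = contradiction w≡v (x∈p-y⇒x≢y w∈)
      ... | inj₂ (_ , eq) = drop-there
        (subst (_∈ inside ∷ P) eq (∈preimage⁻ (proj₁ (x∈p-y-z⁻ u v w∈))))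

    -- A separator of G.e that avoids the new vertex separates G already, so only
    -- separators of G containing both u and v matter.
    contract-k-connected : ∀ {k} → KConnected k G → k + 2 ≤ ∣ V G ∣ →
      (∀ S → u ∈ S → v ∈ S → ∣ S ∣ ≤ k → Connected (G ∖ S)) →
      KConnected k G·e
    contract-k-connected {k} k-conn k+2≤∣V∣ conn S (S⊆V , sep) with k ≤? ∣ S ∣
    ... | yes k≤∣S∣ = k≤∣S∣
    ... | no  k≰∣S∣ = contradiction sep [ (λ ¬conn → ¬conn (conn·e S S⊆V ∣S∣<k)) , <⇒≱ 1< ]
      where
      ∣S∣<k = ≰⇒> k≰∣S∣
      1< : 1 < ∣ V (G·e ∖ S) ∣
      -- Contraction loses at most one vertex, and at most one would survive the deletion of `S`, so
      -- `G` would have fewer than `k + 2`.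
      1< = ≰⇒> λ ≤1 → <-irrefl refl (begin-strict
        ∣ V G ∣                         ≤⟨ ∣V∣≤1+∣V·e∣ ⟩
        suc ∣ V G·e ∣                   ≤⟨ s≤s (∣p∣≤∣p∩∁q∣+∣q∣ (V G·e) S) ⟩
        suc (∣ V (G·e ∖ S) ∣ + ∣ S ∣)   ≤⟨ s≤s (+-mono-≤ ≤1 ≤-refl) ⟩
        2 + ∣ S ∣                       <⟨ s≤s (s≤s ∣S∣<k) ⟩
        2 + k                           ≡⟨ +-comm 2 k ⟩
        k + 2                           ≤⟨ k+2≤∣V∣ ⟩
        ∣ V G ∣                         ∎)
        where open ≤-Reasoning
      conn·e : ∀ S → S ⊆ V G·e → ∣ S ∣ < k → Connected (G·e ∖ S)
      -- Expanding the new vertex adds at most one to a size below `k`, so the bound `k` of the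
      -- hypothesis is met.
      conn·e (true ∷ P) _ ∣S∣<k = preimage-connected {true ∷ P} (conn (preimage (true ∷ P))
        (∈preimage⁺ {true ∷ P} (subst (_∈ true ∷ P) (sym collapse-u) here))
        (∈preimage⁺ {true ∷ P} (subst (_∈ true ∷ P) (sym collapse-v) here))
        (≤-trans (∣preimage∣-inside P) ∣S∣<k))
      conn·e (false ∷ P) S⊆V ∣S∣<k = preimage-connected {false ∷ P}
        -- Connectedness is decidable, so it is enough to refute a separator of `G` with fewer than
        -- `k` vertices.
        (decidable-stable (connected? (G ∖ preimage (false ∷ P))) λ ¬conn →
          <⇒≱ (≤-<-trans (∣preimage∣-outside P) ∣S∣<k)
              (k≤∣separator∣ G k-conn (preimage⊆V S⊆V , ¬conn)))

    -- Replacing `u` and `v` in `S` by the new vertex saves one element, and the graphs left after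
    -- the two deletions are the same up to renaming.
    contract-separator : ∀ {S} → u ∈ S → v ∈ S → Separator G S →
                         ∃ λ S′ → Separator G·e S′ × ∣ S′ ∣ < ∣ S ∣
    contract-separator {S} u∈S v∈S (S⊆V , ¬conn) = S·e , (S·e⊆V , ¬conn ∘ conn-G) , ∣S·e∣<∣S∣
      where
      S·e = inside ∷ (S - u - v)
      ∣S·e∣<∣S∣ : ∣ S·e ∣ < ∣ S ∣
      ∣S·e∣<∣S∣ = begin-strict
        suc ∣ S - u - v ∣  ≤⟨ x∈p⇒∣p-x∣<∣p∣ (x∈p∧x≢y⇒x∈p-y v∈S λ { refl → irrefl G refl uv }) ⟩
        ∣ S - u ∣          <⟨ x∈p⇒∣p-x∣<∣p∣ u∈S ⟩
        ∣ S ∣              ∎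
        where open ≤-Reasoning
      S·e⊆V : S·e ⊆ V G·e
      S·e⊆V here       = here
      S·e⊆V (there w∈) = there
        (let w∈S , w≢u , w≢v = x∈p-y-z⁻ u v w∈ in x∈p-y-z⁺ (S⊆V w∈S) w≢u w≢v)
      ∉S : ∀ {w} → w ∈ V G - u - v → suc w ∉ S·e → w ∉ S
      ∉S w∈ w∉ w∈S = w∉ (there
        (let _ , w≢u , w≢v = x∈p-y-z⁻ u v w∈ in x∈p-y-z⁺ w∈S w≢u w≢v))
      lift-walk : ∀ {a b} → Star (Adj (G·e ∖ S·e)) (suc a) (suc b) → Star (Adj (G ∖ S)) a b
      lift-walk ε = ε
      lift-walk ((old-new _ _ , _ , z∈) ◅ _) = contradiction here (x∈∁p⇒x∉p z∈)
      lift-walk ((old-old a∈ c∈ ac , sa∈ , sc∈) ◅ walk) =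
        (ac , x∉p⇒x∈∁p (∉S a∈ (x∈∁p⇒x∉p sa∈)) , x∉p⇒x∈∁p (∉S c∈ (x∈∁p⇒x∉p sc∈))) ◅ lift-walk walk
      lift-vertex : ∀ {w} → w ∈ V (G ∖ S) → suc w ∈ V (G·e ∖ S·e)
      lift-vertex w∈ with x∈p∩q⁻ (V G) _ w∈
      ... | w∈V , w∈∁S = x∈p∩q⁺ {p = V G·e} {q = ∁ S·e}
        ( there (x∈p-y-z⁺ w∈V (λ { refl → w∉S u∈S }) (λ { refl → w∉S v∈S }))
        , x∉p⇒x∈∁p λ { (there w∈S) → w∉S (proj₁ (x∈p-y-z⁻ u v w∈S)) } )
        where w∉S = x∈∁p⇒x∉p w∈∁S
      conn-G : Connected (G·e ∖ S·e) → Connected (G ∖ S)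
      conn-G conn a∈ b∈ = lift-walk (conn (lift-vertex a∈) (lift-vertex b∈))

-- Contractibility and the sizes of label intersections.

k≤κ⇔k-connected : ∀ (G : Graph n) {k} → k ≤ κ G ⇔ KConnected k G
k≤κ⇔k-connected G {k} = mk⇔
  (λ k≤κ S → ≤-trans k≤κ ∘ proj₂ (proj₂ (vertexConnectivity G)))
  (λ k-conn → k≤attained k-conn (proj₁ (proj₂ (vertexConnectivity G))))
  where
  -- The attained size is a variable `j`, so matching on `refl` need not compare it with `κ G`.
  k≤attained : ∀ {j} → KConnected k G → (∃ λ S → Disconnecting G S × ∣ S ∣ ≡ j) → k ≤ j
  k≤attained k-conn (S , dis , refl) = k-conn S dis

contract-k-connected⇔ :
  ∀ {G : Graph n} {k} → KConnected k G → ∣ V G ∣ ≥ k + 2 →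
  (D : TreeDecomposition G m) →
  (∀ {x} → x ∈ V (T D) → MaximalClique G (label D x)) →
  ∀ {u v} → Adj G u v →
  KConnected k (contract G u v) ⇔
  ( InUniqueMaximalClique G u v
  ⊎ (∀ {x y} → Adj (T D) x y →
       u ∈ label D x ∩ label D y → v ∈ label D x ∩ label D y →
       ∣ label D x ∩ label D y ∣ > k) )
contract-k-connected⇔ {G = G} {k} k-conn k+2≤∣V∣ D maximal {u} {v} uv =
  mk⇔ {B = InUniqueMaximalClique G u v ⊎ LargeEdges}
      (λ k-conn·e → inj₂ (large k-conn·e)) condition⇒k-conn
  where
  LargeEdges = ∀ {x y} → Adj (T D) x y →
    u ∈ label D x ∩ label D y → v ∈ label D x ∩ label D y → ∣ label D x ∩ label D y ∣ > k

  k<∣V∣ : k < ∣ V G ∣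
  k<∣V∣ = begin-strict
    k        <⟨ n≤1+n _ ⟩
    2 + k    ≡⟨ +-comm 2 k ⟩
    k + 2    ≤⟨ k+2≤∣V∣ ⟩
    ∣ V G ∣  ∎
    where open ≤-Reasoning

  equal⇒large : ∀ {x y} → Adj (T D) x y → label D x ≡ label D y →
                ∣ label D x ∩ label D y ∣ > k
  equal⇒large {x} xy x≡y rewrite sym x≡y | ∩-idem (label D x) =
    k<∣label∣ D maximal k-conn k<∣V∣ (adj⇒∈V (T D) xy)

  -- A separating intersection through `e` with at most `k` vertices would shrink to a separator of
  -- `G.e` with fewer than `k`.
  large : KConnected k (contract G u v) → LargeEdges
  large k-conn·e {x} {y} xy u∈ v∈ with edge-≡⊎separates D maximal xy
  ... | inj₁ x≡y = equal⇒large xy x≡y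
  ... | inj₂ (sep , _) with k <? ∣ label D x ∩ label D y ∣
  ...   | yes k< = k<
  ...   | no  k≮ with contract-separator G u v uv u∈ v∈ sep
  ...     | _ , sep·e , ∣S·e∣<∣L∣ = contradiction
    (k≤∣separator∣ (contract G u v) k-conn·e sep·e) (<⇒≱ (<-≤-trans ∣S·e∣<∣L∣ (≮⇒≥ k≮)))

  -- Both end labels are maximal cliques containing `e`, hence equal, and their intersection is a
  -- whole label.
  unique⇒large : InUniqueMaximalClique G u v → LargeEdges
  unique⇒large (_ , _ , unique) {x} {y} xy u∈ v∈
    with x∈p∩q⁻ (label D x) (label D y) u∈ | x∈p∩q⁻ (label D x) (label D y) v∈
  ... | u∈x , u∈y | v∈x , v∈y = equal⇒large xy
    (trans (sym (unique (maximal (adj⇒∈V (T D) xy) , u∈x , v∈x)))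
           (unique (maximal (adj⇒∈V (T D) (symm (T D) xy)) , u∈y , v∈y)))

  connected : LargeEdges → ∀ S → u ∈ S → v ∈ S → ∣ S ∣ ≤ k → Connected (G ∖ S)
  connected edges S u∈S v∈S ∣S∣≤k = connected-∖ D maximal S link
    where
    link : ∀ {x y} → Adj (T D) x y → ∃ λ w → w ∈ label D x ∩ label D y × w ∉ S
    link {x} {y} xy with ⊆⊎∃∉ (label D x ∩ label D y) S
    ... | inj₂ w∈  = w∈
    -- By size, an intersection inside `S` equals `S`, so it contains `u` and `v` and must exceed
    -- `k`.
    ... | inj₁ L⊆S = contradiction (p⊆q⇒∣p∣≤∣q∣ L⊆S)
                       (<⇒≱ (≤-<-trans ∣S∣≤k (edges xy (S⊆L u∈S) (S⊆L v∈S))))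
      where
      S⊆L : S ⊆ label D x ∩ label D y
      S⊆L = p⊆q∧∣q∣≤∣p∣⇒q⊆p L⊆S (≤-trans ∣S∣≤k (k≤∣edge∣ D maximal k-conn k<∣V∣ xy))

  condition⇒k-conn : InUniqueMaximalClique G u v ⊎ LargeEdges → KConnected k (contract G u v)
  condition⇒k-conn (inj₁ unique) =
    contract-k-connected G u v uv k-conn k+2≤∣V∣ (connected (unique⇒large unique))
  condition⇒k-conn (inj₂ edges)  =
    contract-k-connected G u v uv k-conn k+2≤∣V∣ (connected edges)

theorem2 : ∀ {n m} (G : Graph n) (k : ℕ) →
    κ G ≡ k → Chordal G → ∣ V G ∣ ≥ k + 2 →
    (D : TreeDecomposition G m) →
    (∀ {x} → x ∈ V (T D) → MaximalClique G (label D x)) →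
    ∀ {u v} → Adj G u v →
    Contractible G u v ⇔
    ( InUniqueMaximalClique G u v
    ⊎ (∀ {x y} → Adj (T D) x y →
    u ∈ label D x ∩ label D y → v ∈ label D x ∩ label D y →
    ∣ label D x ∩ label D y ∣ > k) )
-- With `k` identified with `κ G`, reflexivity makes `G` `k`-connected, and contractibility reads
-- `k ≤ κ (contract G u v)`.
theorem2 G k refl _ k+2≤∣V∣ D maximal {u} {v} uv =
  contract-k-connected⇔ (Equivalence.to (k≤κ⇔k-connected G) ≤-refl) k+2≤∣V∣ D maximal uv
    ⇔-∘ k≤κ⇔k-connected (contract G u v)
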